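{- Let $\mathbb F$ be a field and let $T\in(\mathbb F^n)^{\otimes d}$ and $U\in(\mathbb F^m)^{\otimes d}$ be $d$-mode tensors, where $T$ has asymptotic rank exponent $\omega(T)=r\ge 1$ and $U$ has asymptotic circuit complexity exponent $\eta(U)=s\ge 1$. Then the asymptotic circuit complexity exponent of $T\otimes U$ satisfies $\eta(T\otimes U)\le r+s$.
   Context: A $d$-mode tensor over $\mathbb F$ is a polynomial in variables partitioned into $d$ nonempty disjoint sets $X_1,\dots,X_d$ (modes) all of whose monomials contain exactly one variable from each mode, with degree one; $(\mathbb F^n)^{\otimes d}$ denotes those in which each mode has $n$ variables. The Kronecker product $S\otimes T$ of $d$-mode tensors with modes $X_i$ and $Y_i$ is the polynomial product $ST$, viewed as a $d$-mode tensor with modes $X_i\times Y_i$ (a product $xy$ with $x\in X_i$, $y\in Y_i$ is regarded as one variable); $T^{\otimes k}$ is the $k$-fold Kronecker power. The rank $\mathrm R(T)$ is the least number of tensors of the form $\ell_1\cdots\ell_d$ ($\ell_j$ a linear form in $X_j$) with sum $T$. An arithmetic circuit is a directed acyclic graph whose sources (inputs) are labeled by field elements or variables, whose other vertices (gates) are labeled $+$ or $\times$ (with arbitrary fan-in), and whose edges (wires) are labeled by field elements by which the transmitted value is multiplied; its size is the number of wires, and $\mathrm C(T)$ is the minimum size of an arithmetic circuit over $\mathbb F$ computing $T$. For $T\in(\mathbb F^n)^{\otimes d}$, $\omega(T)=\inf\{\beta\ge0:\mathrm R(T^{\otimes k})=O(n^{\beta k})\}$ and $\eta(T)=\inf\{\beta\ge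 0:\mathrm C(T^{\otimes k})=O(n^{\beta k})\}$ (as $k\to\infty$). Note that $T\otimes U\in(\mathbb F^{nm})^{\otimes d}$. -}

module Defs where

open import Algebra.Apartness.Bundles using (HeytingField; HeytingCommutativeRing)
open import Algebra.Bundles using (CommutativeRing; CommutativeSemiring; Semiring)
import Algebra.Definitions.RawSemiring as RawSemiringOps
open import Algebra.Structures.Biased using (IsCommutativeSemiringˡ)
open import Data.Fin.Base using (Fin; zero; suc; quotient; remainder)
open import Data.List.Base using (foldr)
open import Data.List.NonEmpty using (List⁺; toList; length)
open import Data.Nat.Base as ℕ using (ℕ; zero; suc; NonZero)
open import Data.Integer.Base using (+_)
open import Data.Product.Base using (∃-syntax; Σ-syntax; _×_; _,_)
open import Data.Rational.Base as ℚ using (ℚ; 0ℚ; 1ℚ)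
import Data.Rational.Properties as ℚ
open import Data.Rational.Solver using (module +-*-Solver)
open import Data.Vec.Base using (Vec; []; _∷_; lookup; map)
open import Level using (Level; _⊔_; 0ℓ) renaming (suc to lsuc)
open import Relation.Binary.Structures using (IsEquivalence)
open import Relation.Binary.PropositionalEquality using (_≡_; refl; subst; subst₂)

-- Dedekind reals.  `located` is the two-sided-approximation form of
-- locatedness; it also gives that both cuts are inhabited.
record ℝ : Set₁ where
  field
    L U      : ℚ → Set
    L-closed : ∀ {p q} → p ℚ.< q → L q → L p
    L-open   : ∀ {p} → L p → ∃[ q ] (p ℚ.< q × L q)
    U-closed : ∀ {p q} → p ℚ.< q → U p → U q
    U-open   : ∀ {q} → U q → ∃[ p ] (p ℚ.< q × U p)
    disjoint : ∀ {p q} → L p → U q → p ℚ.< q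
    located  : ∀ ε → 0ℚ ℚ.< ε → ∃[ p ] ∃[ q ] (L p × U q × q ℚ.< p ℚ.+ ε)

module Real where

  open ℝ
  open +-*-Solver

  infix 4 _≤_ _<_
  infixl 6 _+_

  _≤_ : ℝ → ℝ → Set
  x ≤ y = ∀ q → L x q → L y q

  _<_ : ℝ → ℝ → Set
  x < y = ∃[ q ] (U x q × L y q)

  fromℚ : ℚ → ℝ
  fromℚ r = record
    { L        = λ p → p ℚ.< r
    ; U        = λ q → r ℚ.< q
    ; L-closed = ℚ.<-trans
    ; L-open   = ℚ.<-dense
    ; U-closed = λ p<q r<p → ℚ.<-trans r<p p<q
    ; U-open   = λ r<q → let m , r<m , m<q = ℚ.<-dense r<q in m , m<q , r<m
    ; disjoint = ℚ.<-trans
    ; located  = λ ε 0<ε →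
        let δ , 0<δ , δ<ε = ℚ.<-dense 0<ε
            r<r-δ+ε = subst₂ ℚ._<_
              (solve 2 (λ r δ → (r :- δ) :+ δ := r) refl r δ) refl
              (ℚ.+-monoʳ-< (r ℚ.- δ) δ<ε)
            m , r<m , m<r-δ+ε = ℚ.<-dense r<r-δ+ε
            r-δ<r = subst₂ ℚ._<_
              (ℚ.+-identityʳ (r ℚ.- δ))
              (solve 2 (λ r δ → (r :- δ) :+ δ := r) refl r δ)
              (ℚ.+-monoʳ-< (r ℚ.- δ) 0<δ)
        in r ℚ.- δ , m , r-δ<r , r<m , m<r-δ+ε
    }

  0ℝ 1ℝ : ℝ
  0ℝ = fromℚ 0ℚ
  1ℝ = fromℚ 1ℚ

  _+_ : ℝ → ℝ → ℝ
  x + y = record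
    { L        = λ q → ∃[ a ] ∃[ b ] (L x a × L y b × q ℚ.≤ a ℚ.+ b)
    ; U        = λ q → ∃[ a ] ∃[ b ] (U x a × U y b × a ℚ.+ b ℚ.≤ q)
    ; L-closed = λ { p<q (a , b , la , lb , q≤) →
                     a , b , la , lb , ℚ.≤-trans (ℚ.<⇒≤ p<q) q≤ }
    ; L-open   = λ { (a , b , la , lb , p≤) →
                     let a′ , a<a′ , la′ = L-open x la in
                     a′ ℚ.+ b , ℚ.≤-<-trans p≤ (ℚ.+-monoˡ-< b a<a′)
                     , a′ , b , la′ , lb , ℚ.≤-refl }
    ; U-closed = λ { p<q (a , b , ua , ub , ≤p) →
                     a , b , ua , ub , ℚ.≤-trans ≤p (ℚ.<⇒≤ p<q) }
    ; U-open   = λ { (a , b , ua , ub , ≤q) →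
                     let a′ , a′<a , ua′ = U-open x ua in
                     a′ ℚ.+ b , ℚ.<-≤-trans (ℚ.+-monoˡ-< b a′<a) ≤q
                     , a′ , b , ua′ , ub , ℚ.≤-refl }
    ; disjoint = λ { (a , b , la , lb , p≤) (a′ , b′ , ua , ub , ≤q) →
                     ℚ.≤-<-trans p≤ (ℚ.<-≤-trans
                       (ℚ.+-mono-< (disjoint x la ua) (disjoint y lb ub)) ≤q) }
    ; located  = λ ε 0<ε →
        let δ , 0<δ , δ<ε = ℚ.<-dense 0<ε
            0<ε-δ = subst (ℚ._< ε ℚ.- δ) (ℚ.+-inverseʳ δ) (ℚ.+-monoˡ-< (ℚ.- δ) δ<ε)
            a , a′ , la , ua , a′< = located x δ 0<δ
            b , b′ , lb , ub , b′< = located y (ε ℚ.- δ) 0<ε-δ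
        in a ℚ.+ b , a′ ℚ.+ b′
         , (a , b , la , lb , ℚ.≤-refl) , (a′ , b′ , ua , ub , ℚ.≤-refl)
         , subst (a′ ℚ.+ b′ ℚ.<_)
             (solve 4 (λ a b δ ε → (a :+ δ) :+ (b :+ (ε :- δ)) := (a :+ b) :+ ε)
                refl a b δ ε)
             (ℚ.+-mono-< a′< b′<)
    }

  -- inf S ≤ x
  Inf≤ : ∀ {ℓ} → (ℝ → Set ℓ) → ℝ → Set (lsuc 0ℓ ⊔ ℓ)
  Inf≤ S x = ∀ y → x < y → ∃[ β ] (S β × β < y)

  -- inf S = x
  IsInf : ∀ {ℓ} → (ℝ → Set ℓ) → ℝ → Set (lsuc 0ℓ ⊔ ℓ)
  IsInf S x = (∀ β → S β → x ≤ β) × Inf≤ S x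

  -- N ≤ c · n^(β k) for β ≥ 0 and n ≥ 1, where
  -- n^(β k) = inf { n^((a/b) k) ∣ a/b > β }, with b-th roots cleared.
  PowBound : (c n : ℕ) (β : ℝ) (k N : ℕ) → Set
  PowBound c n β k N = ∀ a b .{{_ : NonZero b}} → U β (+ a ℚ./ b) →
    N ℕ.^ b ℕ.≤ c ℕ.^ b ℕ.* n ℕ.^ (a ℕ.* k)

  -- min (P k) = O(n^(β k)) as k → ∞, for sets P k of naturals: the minimum of
  -- a set is at most a bound iff some member is.
  MinIsO : ∀ {ℓ} → (P : ℕ → ℕ → Set ℓ) (n : ℕ) (β : ℝ) → Set ℓ
  MinIsO P n β =
    ∃[ c ] ∃[ K ] ∀ k → K ℕ.≤ k → ∃[ N ] (P k N × PowBound c n β k N)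

  -- { β ≥ 0 ∣ min (P k) = O(n^(β k)) }
  Exponents : ∀ {ℓ} → (P : ℕ → ℕ → Set ℓ) (n : ℕ) → ℝ → Set ℓ
  Exponents P n β = 0ℝ ≤ β × MinIsO P n β

-- Classically a Heyting field is the same thing as a field.
module Over {c ℓ₁ ℓ₂ : Level} (F : HeytingField c ℓ₁ ℓ₂) where

  open HeytingField F
    using (Carrier; _≈_; _+_; _*_; 0#; 1#; heytingCommutativeRing)
  open HeytingCommutativeRing heytingCommutativeRing using (commutativeRing)
  open CommutativeRing commutativeRing using (semiring)
  open RawSemiringOps (Semiring.rawSemiring semiring)
    using (sum; product)

  -- The polynomial ring F[V], presented as the free commutative F-algebra on V.
  -- Negation is multiplication by con (- 1#).
  module Polynomial (V : Set) where

    infixl 6 _⊕_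
    infixl 7 _⊙_
    infix 4 _≋_

    data Poly : Set c where
      con     : Carrier → Poly
      var     : V → Poly
      _⊕_ _⊙_ : Poly → Poly → Poly

    data _≋_ : Poly → Poly → Set (c ⊔ ℓ₁) where
      ≋-refl      : ∀ {p} → p ≋ p
      ≋-sym       : ∀ {p q} → p ≋ q → q ≋ p
      ≋-trans     : ∀ {p q r} → p ≋ q → q ≋ r → p ≋ r
      ⊕-cong      : ∀ {p p′ q q′} → p ≋ p′ → q ≋ q′ → p ⊕ q ≋ p′ ⊕ q′
      ⊙-cong      : ∀ {p p′ q q′} → p ≋ p′ → q ≋ q′ → p ⊙ q ≋ p′ ⊙ q′
      con-cong    : ∀ {a b} → a ≈ b → con a ≋ con b
      con-+       : ∀ a b → con (a + b) ≋ con a ⊕ con b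
      con-*       : ∀ a b → con (a * b) ≋ con a ⊙ con b
      ⊕-assoc     : ∀ p q r → (p ⊕ q) ⊕ r ≋ p ⊕ (q ⊕ r)
      ⊕-comm      : ∀ p q → p ⊕ q ≋ q ⊕ p
      ⊕-identityˡ : ∀ p → con 0# ⊕ p ≋ p
      ⊙-assoc     : ∀ p q r → (p ⊙ q) ⊙ r ≋ p ⊙ (q ⊙ r)
      ⊙-comm      : ∀ p q → p ⊙ q ≋ q ⊙ p
      ⊙-identityˡ : ∀ p → con 1# ⊙ p ≋ p
      ⊙-zeroˡ     : ∀ p → con 0# ⊙ p ≋ con 0#
      ⊙-distribʳ  : ∀ p q r → (q ⊕ r) ⊙ p ≋ (q ⊙ p) ⊕ (r ⊙ p)

    commutativeSemiring : CommutativeSemiring c (c ⊔ ℓ₁)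
    commutativeSemiring = record
      { Carrier = Poly
      ; _≈_ = _≋_
      ; _+_ = _⊕_
      ; _*_ = _⊙_
      ; 0#  = con 0#
      ; 1#  = con 1#
      ; isCommutativeSemiring = IsCommutativeSemiringˡ.isCommutativeSemiring record
          { +-isCommutativeMonoid = record
              { isMonoid = record
                  { isSemigroup = record
                      { isMagma = record
                          { isEquivalence = ≋-equiv
                          ; ∙-cong = ⊕-cong
                          }
                      ; assoc = ⊕-assoc
                      }
                  ; identity = ⊕-identityˡ , λ p → ≋-trans (⊕-comm p _) (⊕-identityˡ p)
                  }
              ; comm = ⊕-comm
              }
          ; *-isCommutativeMonoid = record
              { isMonoid = record
                  { isSemigroup = record
                      { isMagma = record
                          { isEquivalence = ≋-equiv
                          ; ∙-cong = ⊙-cong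
                          }
                      ; assoc = ⊙-assoc
                      }
                  ; identity = ⊙-identityˡ , λ p → ≋-trans (⊙-comm p _) (⊙-identityˡ p)
                  }
              ; comm = ⊙-comm
              }
          ; distribʳ = ⊙-distribʳ
          ; zeroˡ = ⊙-zeroˡ
          }
      }
      where
      ≋-equiv : IsEquivalence _≋_
      ≋-equiv = record { refl = ≋-refl ; sym = ≋-sym ; trans = ≋-trans }

  -- A d-mode tensor with n variables in each mode, given by its coefficients:
  -- T v is the coefficient of the monomial ∏ⱼ x(j, vⱼ).
  Tensor : (d n : ℕ) → Set c
  Tensor d n = Vec (Fin n) d → Carrier

  Variable : (d n : ℕ) → Set
  Variable d n = Fin d × Fin n

  module _ {d n : ℕ} where

    open Polynomial (Variable d n)
    open RawSemiringOps (CommutativeSemiring.rawSemiring commutativeSemiring)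
      using () renaming (sum to ∑; product to ∏)

    ∑-multi : ∀ {e} → (Vec (Fin n) e → Poly) → Poly
    ∑-multi {zero}  f = f []
    ∑-multi {suc e} f = ∑ λ i → ∑-multi λ v → f (i ∷ v)

    toPoly : Tensor d n → Poly
    toPoly T = ∑-multi λ v → con (T v) ⊙ ∏ λ j → var (j , lookup v j)

  -- Fin (n * m) stands for Fin n × Fin m.
  infixl 7 _⊗_
  _⊗_ : ∀ {d n m} → Tensor d n → Tensor d m → Tensor d (n ℕ.* m)
  _⊗_ {n = n} {m} T U v = T (map (quotient m) v) * U (map (remainder {n} m) v)

  infixr 8 _⊗^_
  _⊗^_ : ∀ {d n} → Tensor d n → (k : ℕ) → Tensor d (n ℕ.^ k)
  T ⊗^ zero  = λ _ → 1#
  T ⊗^ suc k = T ⊗ (T ⊗^ k)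

  -- ℓ₁ ⋯ ℓ_d for linear forms ℓⱼ in the j-th mode, given by their coefficients
  simple : ∀ {d n} → (Fin d → Fin n → Carrier) → Tensor d n
  simple ℓ v = product λ j → ℓ j (lookup v j)

  -- T is a sum of ρ simple tensors, so R(T) is the least ρ with SumOfSimple T ρ.
  SumOfSimple : ∀ {d n} → Tensor d n → ℕ → Set (c ⊔ ℓ₁)
  SumOfSimple {d} {n} T ρ =
    Σ[ ℓ ∈ (Fin ρ → Fin d → Fin n → Carrier) ]
      ∀ v → T v ≈ sum λ i → simple (ℓ i) v

  module ArithmeticCircuit (V : Set) where

    open Polynomial V

    data Op : Set where
      plus times : Op

    -- A wire carries its label and the earlier vertex it comes from.
    Wire : ℕ → Set c
    Wire N = Carrier × Fin N

    data Vertex (N : ℕ) : Set c where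
      constant : Carrier → Vertex N
      input    : V → Vertex N
      gate     : Op → List⁺ (Wire N) → Vertex N

    -- A circuit with N vertices, listed in a topological order; the vertex
    -- added last has index zero.
    data Circuit : ℕ → Set c where
      []  : Circuit 0
      _▷_ : ∀ {N} → Circuit N → Vertex N → Circuit (suc N)

    transmit : ∀ {N} → (Fin N → Poly) → Wire N → Poly
    transmit val (a , i) = con a ⊙ val i

    vertexValue : ∀ {N} → (Fin N → Poly) → Vertex N → Poly
    vertexValue val (constant a)    = con a
    vertexValue val (input x)       = var x
    vertexValue val (gate plus ws)  =
      foldr (λ w p → transmit val w ⊕ p) (con 0#) (toList ws)
    vertexValue val (gate times ws) =
      foldr (λ w p → transmit val w ⊙ p) (con 1#) (toList ws)

    value : ∀ {N} → Circuit N → Fin N → Poly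
    value (C ▷ g) zero    = vertexValue (value C) g
    value (C ▷ g) (suc i) = value C i

    fanIn : ∀ {N} → Vertex N → ℕ
    fanIn (constant _)  = 0
    fanIn (input _)     = 0
    fanIn (gate _ ws)   = length ws

    size : ∀ {N} → Circuit N → ℕ
    size []      = 0
    size (C ▷ g) = size C ℕ.+ fanIn g

  -- Some circuit of size s computes T, so C(T) is the least s with
  -- ComputedInSize T s.
  ComputedInSize : ∀ {d n} → Tensor d n → ℕ → Set (c ⊔ ℓ₁)
  ComputedInSize {d} {n} T s =
    ∃[ N ] Σ[ C ∈ Circuit N ] Σ[ out ∈ Fin N ]
      (value C out ≋ toPoly T × size C ≡ s)
    where
    open Polynomial (Variable d n)
    open ArithmeticCircuit (Variable d n)

  RankExponents : ∀ {d n} → Tensor d n → ℝ → Set (c ⊔ ℓ₁)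
  RankExponents {n = n} T = Real.Exponents (λ k → SumOfSimple (T ⊗^ k)) n

  CircuitExponents : ∀ {d n} → Tensor d n → ℝ → Set (c ⊔ ℓ₁)
  CircuitExponents {n = n} T = Real.Exponents (λ k → ComputedInSize (T ⊗^ k)) n

  ω_≐_ : ∀ {d n} → Tensor d n → ℝ → Set (lsuc 0ℓ ⊔ c ⊔ ℓ₁)
  ω T ≐ r = Real.IsInf (RankExponents T) r

  η_≐_ : ∀ {d n} → Tensor d n → ℝ → Set (lsuc 0ℓ ⊔ c ⊔ ℓ₁)
  η T ≐ s = Real.IsInf (CircuitExponents T) s

  η_≲_ : ∀ {d n} → Tensor d n → ℝ → Set (lsuc 0ℓ ⊔ c ⊔ ℓ₁)
  η T ≲ x = Real.Inf≤ (CircuitExponents T) x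

module Submission where

open import Algebra.Apartness.Bundles using (HeytingField; HeytingCommutativeRing)
open import Algebra.Bundles using (CommutativeRing; CommutativeSemiring; Semiring)
import Algebra.Definitions.RawSemiring as RawSemiringOps
import Algebra.Properties.CommutativeMonoid.Sum as CommutativeMonoidSum
import Algebra.Properties.CommutativeSemigroup as CommutativeSemigroupProperties
import Algebra.Properties.Semiring.Sum as SemiringSum
open import Data.Bool.Base using (if_then_else_; true; false)
open import Data.Fin.Base using (Fin; zero; suc; combine; quotient; remainder)
open import Data.Fin.Properties using (_≟_; remQuot-combine)
open import Data.Integer.Base as ℤ using (+_; -[1+_])
import Data.Integer.Properties as ℤ
open import Data.List.Base as List using ([]; _∷_; foldr)
open import Data.List.NonEmpty as List⁺ using (_∷_)
open import Data.List.Properties using (length-map; length-tabulate)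
open import Data.Nat.Base as ℕ using (ℕ; zero; suc; NonZero)
import Data.Nat.Properties as ℕ
open import Data.Nat.Tactic.RingSolver using (solve-∀)
open import Data.Product.Base using (∃-syntax; Σ-syntax; _×_; _,_; proj₁; proj₂; uncurry)
open import Data.Rational.Base as ℚ using (ℚ; 0ℚ; 1ℚ)
import Data.Rational.Properties as ℚ
open import Data.Rational.Unnormalised.Base as ℚᵘ using (*≤*)
import Data.Rational.Unnormalised.Properties as ℚᵘ
open import Data.Sum.Base using (inj₁; inj₂)
open import Data.Unit.Base using (⊤; tt)
open import Data.Vec.Base using (Vec; []; _∷_; lookup; map)
open import Data.Vec.Properties using (lookup-map; map-∘; map-cong)
open import Function.Base using (_∘_)
open import Level using (_⊔_)
open import Relation.Binary.PropositionalEquality as ≡ using (_≡_)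
open import Relation.Nullary.Decidable using (does)
open import Defs

-- Write the k-th power of T ⊗ U as T^{⊗k} ⊗ U^{⊗k}.  Given T^{⊗k} = ∑ᵢ ∏ⱼ ℓᵢⱼ,
-- the summand ∏ⱼ ℓᵢⱼ ⊗ U^{⊗k} is U^{⊗k} with each variable of its j-th mode
-- replaced by a linear form, so one copy of a circuit for U^{⊗k} per i, fed by
-- these forms, computes the power.  Even if every form is written with all (nm)^k
-- variables of its mode, the total size is about n^{rk} (d n^k m^{2k} + m^{sk}),
-- which is O((nm)^{(r+s)k}) because r, s ≥ 1.

-- Sums over multi-indices in a commutative semiring.

module MultiSum {c ℓ} (R : CommutativeSemiring c ℓ) where

  open CommutativeSemiring R hiding (zero)
  open RawSemiringOps rawSemiring using () renaming (sum to ∑; product to ∏)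
  open SemiringSum semiring using (sum-cong-≋; ∑-comm; *-distribˡ-sum; *-distribʳ-sum; sum-replicate-zero)
  open CommutativeSemigroupProperties *-commutativeSemigroup using (x∙yz≈y∙xz)
  open import Relation.Binary.Reasoning.Setoid setoid

  multiSum : ∀ {n e} → (Vec (Fin n) e → Carrier) → Carrier
  multiSum {e = zero}  f = f []
  multiSum {e = suc e} f = ∑ λ i → multiSum λ v → f (i ∷ v)

  multiSum-cong : ∀ {n e} {f g : Vec (Fin n) e → Carrier} →
    (∀ v → f v ≈ g v) → multiSum f ≈ multiSum g
  multiSum-cong {e = zero}  f≈g = f≈g []
  multiSum-cong {e = suc e} f≈g =
    sum-cong-≋ λ i → multiSum-cong λ v → f≈g (i ∷ v)

  multiSum-∑ : ∀ {n e ρ} (f : Fin ρ → Vec (Fin n) e → Carrier) →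
    multiSum (λ v → ∑ λ i → f i v) ≈ ∑ λ i → multiSum (f i)
  multiSum-∑ {e = zero}  f = refl
  multiSum-∑ {e = suc e} f = trans
    (sum-cong-≋ λ j → multiSum-∑ λ i v → f i (j ∷ v))
    (∑-comm λ j i → multiSum λ v → f i (j ∷ v))

  *-distribˡ-multiSum : ∀ {n e} x (f : Vec (Fin n) e → Carrier) →
    x * multiSum f ≈ multiSum λ v → x * f v
  *-distribˡ-multiSum {e = zero}  x f = refl
  *-distribˡ-multiSum {e = suc e} x f = trans
    (*-distribˡ-sum x λ i → multiSum λ v → f (i ∷ v))
    (sum-cong-≋ λ i → *-distribˡ-multiSum x λ v → f (i ∷ v))

  select : ∀ {n} → Fin n → Fin n → Carrier → Carrier
  select i j x = if does (i ≟ j) then x else 0#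

  -- Through `does`, comparing indices built from `zero` and `suc` reduces by computation, so
  -- recursion on `i` replaces a case split on equality.
  ∑-select : ∀ {n} (i : Fin n) x (f : Fin n → Carrier) →
    ∑ (λ j → select i j x * f j) ≈ x * f i
  ∑-select {suc n} zero x f = begin
    x * f zero + ∑ (λ j → 0# * f (suc j)) ≈⟨ +-congˡ (sum-cong-≋ λ j → zeroˡ (f (suc j))) ⟩
    x * f zero + ∑ {n} (λ _ → 0#)         ≈⟨ +-congˡ (sum-replicate-zero n) ⟩
    x * f zero + 0#                       ≈⟨ +-identityʳ _ ⟩
    x * f zero                            ∎
  ∑-select (suc i) x f = begin
    0# * f zero + ∑ (λ j → select i j x * f (suc j)) ≈⟨ +-cong (zeroˡ _) (∑-select i x (f ∘ suc)) ⟩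
    0# + x * f (suc i)                               ≈⟨ +-identityˡ _ ⟩
    x * f (suc i)                                    ∎

  -- Multiplying out: the factor `s j b` is the sum of `g j p` over the fibre of `π` above `b`, so
  -- choosing a `p` in every mode amounts to choosing a multi-index `v`, and `w` becomes `map π v`.
  -- Induction on the number of modes; the factor of the first mode is pulled out of the inner sums.
  multiSum-substitute : ∀ {M P e} (π : Fin P → Fin M)
    (B : Vec (Fin M) e → Carrier)
    (g : Fin e → Fin P → Carrier) (s : Fin e → Fin M → Carrier) →
    (∀ j b → s j b ≈ ∑ λ p → select (π p) b (g j p)) →
    multiSum (λ w → B w * ∏ λ j → s j (lookup w j)) ≈
    multiSum (λ v → B (map π v) * ∏ λ j → g j (lookup v j))
  multiSum-substitute {e = zero}  π B g s s≈ = refl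
  multiSum-substitute {M} {P} {suc e} π B g s s≈ = begin
    (∑ λ b → multiSum λ w → B (b ∷ w) * (s zero b * ∏ (λ j → s (suc j) (lookup w j))))
      ≈⟨ sum-cong-≋ (λ b → multiSum-cong λ w →
           x∙yz≈y∙xz (B (b ∷ w)) (s zero b) (∏ λ j → s (suc j) (lookup w j))) ⟩
    (∑ λ b → multiSum λ w → s zero b * (B (b ∷ w) * ∏ (λ j → s (suc j) (lookup w j))))
      ≈⟨ sum-cong-≋ (λ b → *-distribˡ-multiSum (s zero b) λ w → B (b ∷ w) * ∏ (λ j → s (suc j) (lookup w j))) ⟨
    (∑ λ b → s zero b * multiSum λ w → B (b ∷ w) * ∏ (λ j → s (suc j) (lookup w j)))
      ≈⟨ sum-cong-≋ (λ b → *-cong (s≈ zero b)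
           (multiSum-substitute π (λ w → B (b ∷ w)) (λ j → g (suc j)) (λ j → s (suc j)) (λ j → s≈ (suc j)))) ⟩
    (∑ λ b → ∑ (λ p → select (π p) b (g zero p)) * X b)
      ≈⟨ sum-cong-≋ (λ b → *-distribʳ-sum (X b) λ p → select (π p) b (g zero p)) ⟩
    (∑ λ b → ∑ λ p → select (π p) b (g zero p) * X b)
      ≈⟨ ∑-comm (λ b p → select (π p) b (g zero p) * X b) ⟩
    (∑ λ p → ∑ λ b → select (π p) b (g zero p) * X b)
      ≈⟨ sum-cong-≋ (λ p → ∑-select (π p) (g zero p) X) ⟩
    (∑ λ p → g zero p * X (π p))
      ≈⟨ sum-cong-≋ (λ p → *-distribˡ-multiSum (g zero p) λ v → B (π p ∷ map π v) * ∏ (λ j → g (suc j) (lookup v j))) ⟩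
    (∑ λ p → multiSum λ v → g zero p * (B (π p ∷ map π v) * ∏ (λ j → g (suc j) (lookup v j))))
      ≈⟨ sum-cong-≋ (λ p → multiSum-cong λ v →
           x∙yz≈y∙xz (g zero p) (B (π p ∷ map π v)) (∏ λ j → g (suc j) (lookup v j))) ⟩
    (∑ λ p → multiSum λ v → B (π p ∷ map π v) * (g zero p * ∏ (λ j → g (suc j) (lookup v j)))) ∎
    where
    X : Fin M → Carrier
    X b = multiSum λ v → B (b ∷ map π v) * ∏ λ j → g (suc j) (lookup v j)

-- Indices of a power of a Kronecker product.

module _ (n m : ℕ) where

  -- An index below `(n * m) ^ k` is a word of `k` digits, each a pair from `Fin n` and `Fin m`. The
  -- first components form the left index and the second components the right one.
  leftIndex : ∀ k → Fin ((n ℕ.* m) ℕ.^ k) → Fin (n ℕ.^ k)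
  leftIndex zero    i = zero
  leftIndex (suc k) i = combine (quotient {n} m (quotient {n ℕ.* m} ((n ℕ.* m) ℕ.^ k) i))
    (leftIndex k (remainder {n ℕ.* m} ((n ℕ.* m) ℕ.^ k) i))

  rightIndex : ∀ k → Fin ((n ℕ.* m) ℕ.^ k) → Fin (m ℕ.^ k)
  rightIndex zero    i = zero
  rightIndex (suc k) i = combine (remainder {n} m (quotient {n ℕ.* m} ((n ℕ.* m) ℕ.^ k) i))
    (rightIndex k (remainder {n ℕ.* m} ((n ℕ.* m) ℕ.^ k) i))

module _ {d p x y : ℕ} (f : Fin p → Fin x) (g : Fin p → Fin y) (v : Vec (Fin p) d) where

  map-quotient-combine : map (quotient {x} y) (map (λ i → combine (f i) (g i)) v) ≡ map f v
  map-quotient-combine = ≡.trans (≡.sym (map-∘ (quotient {x} y) (λ i → combine (f i) (g i)) v))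
    (map-cong (λ i → ≡.cong proj₁ (remQuot-combine (f i) (g i))) v)

  map-remainder-combine : map (remainder {x} y) (map (λ i → combine (f i) (g i)) v) ≡ map g v
  map-remainder-combine = ≡.trans (≡.sym (map-∘ (remainder {x} y) (λ i → combine (f i) (g i)) v))
    (map-cong (λ i → ≡.cong proj₂ (remQuot-combine (f i) (g i))) v)

module _ {c ℓ₁ ℓ₂} (F : HeytingField c ℓ₁ ℓ₂) where

  open Over F
  open HeytingField F
    using (Carrier; _≈_; 0#; 1#; heytingCommutativeRing) renaming (_*_ to _*ᶠ_)
  open HeytingCommutativeRing heytingCommutativeRing using (commutativeRing)
  private module K = CommutativeRing commutativeRing
  open RawSemiringOps (Semiring.rawSemiring K.semiring) using () renaming (sum to sumᶠ; product to productᶠ)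

  -- Substitution in polynomials, and tensors as multi-sums.

  module _ {V V′ : Set} where

    private
      module P = Polynomial V
      module P′ = Polynomial V′
    open P′ using (_⊕_; _⊙_; _≋_; con; var)
    open RawSemiringOps (CommutativeSemiring.rawSemiring P.commutativeSemiring)
      using () renaming (sum to ∑; product to ∏)
    open RawSemiringOps (CommutativeSemiring.rawSemiring P′.commutativeSemiring)
      using () renaming (sum to ∑′; product to ∏′)

    -- The algebra homomorphism that extends `σ`; `substitute-cong` makes it well defined, since
    -- each generating relation of `_≋_` holds in the target too.
    substitute : (V → P′.Poly) → P.Poly → P′.Poly
    substitute σ (P.con a)   = con a
    substitute σ (P.var x)   = σ x
    substitute σ (p P.⊕ q)   = substitute σ p ⊕ substitute σ q
    substitute σ (p P.⊙ q)   = substitute σ p ⊙ substitute σ q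

    substitute-cong : ∀ σ {p q} → p P.≋ q → substitute σ p ≋ substitute σ q
    substitute-cong σ P.≋-refl            = P′.≋-refl
    substitute-cong σ (P.≋-sym e)         = P′.≋-sym (substitute-cong σ e)
    substitute-cong σ (P.≋-trans e f)     = P′.≋-trans (substitute-cong σ e) (substitute-cong σ f)
    substitute-cong σ (P.⊕-cong e f)      = P′.⊕-cong (substitute-cong σ e) (substitute-cong σ f)
    substitute-cong σ (P.⊙-cong e f)      = P′.⊙-cong (substitute-cong σ e) (substitute-cong σ f)
    substitute-cong σ (P.con-cong e)      = P′.con-cong e
    substitute-cong σ (P.con-+ a b)       = P′.con-+ a b
    substitute-cong σ (P.con-* a b)       = P′.con-* a b
    substitute-cong σ (P.⊕-assoc p q r)   = P′.⊕-assoc _ _ _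
    substitute-cong σ (P.⊕-comm p q)      = P′.⊕-comm _ _
    substitute-cong σ (P.⊕-identityˡ p)   = P′.⊕-identityˡ _
    substitute-cong σ (P.⊙-assoc p q r)   = P′.⊙-assoc _ _ _
    substitute-cong σ (P.⊙-comm p q)      = P′.⊙-comm _ _
    substitute-cong σ (P.⊙-identityˡ p)   = P′.⊙-identityˡ _
    substitute-cong σ (P.⊙-zeroˡ p)       = P′.⊙-zeroˡ _
    substitute-cong σ (P.⊙-distribʳ p q r) = P′.⊙-distribʳ _ _ _

    substitute-∑ : ∀ σ {n} (f : Fin n → P.Poly) →
      substitute σ (∑ f) ≡ ∑′ (λ i → substitute σ (f i))
    substitute-∑ σ {zero}  f = ≡.refl
    substitute-∑ σ {suc n} f = ≡.cong (substitute σ (f zero) ⊕_) (substitute-∑ σ (f ∘ suc))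

    substitute-∏ : ∀ σ {n} (f : Fin n → P.Poly) →
      substitute σ (∏ f) ≡ ∏′ (λ i → substitute σ (f i))
    substitute-∏ σ {zero}  f = ≡.refl
    substitute-∏ σ {suc n} f = ≡.cong (substitute σ (f zero) ⊙_) (substitute-∏ σ (f ∘ suc))

  module PolyLemmas (V : Set) where

    open Polynomial V public
    open CommutativeSemiring commutativeSemiring public
      using (semiring; setoid; *-commutativeMonoid; reflexive)
    open RawSemiringOps (CommutativeSemiring.rawSemiring commutativeSemiring) public
      using () renaming (sum to ∑; product to ∏)
    open MultiSum commutativeSemiring public

    con-sum : ∀ {n} (f : Fin n → Carrier) → con (sumᶠ f) ≋ ∑ (λ i → con (f i))
    con-sum {zero}  f = ≋-refl
    con-sum {suc n} f = ≋-trans (con-+ _ _) (⊕-cong ≋-refl (con-sum (f ∘ suc)))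

    con-product : ∀ {n} (f : Fin n → Carrier) → con (productᶠ f) ≋ ∏ (λ i → con (f i))
    con-product {zero}  f = ≋-refl
    con-product {suc n} f = ≋-trans (con-* _ _) (⊙-cong ≋-refl (con-product (f ∘ suc)))

  module _ {d n : ℕ} where

    open PolyLemmas (Variable d n)
    open SemiringSum semiring using (sum-cong-≋)

    -- Gives access to the lemmas on `multiSum`, which are proved for every commutative semiring.
    ∑-multi≋multiSum : ∀ {e} (f : Vec (Fin n) e → Poly) →
      ∑-multi {d} {n} f ≋ multiSum f
    ∑-multi≋multiSum {zero}  f = ≋-refl
    ∑-multi≋multiSum {suc e} f = sum-cong-≋ λ i → ∑-multi≋multiSum λ v → f (i ∷ v)

  module _ {d M P : ℕ} (σ : Variable d M → Polynomial.Poly (Variable d P)) where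

    open PolyLemmas (Variable d P)
    private module Y = Polynomial (Variable d M)
    open RawSemiringOps (CommutativeSemiring.rawSemiring Y.commutativeSemiring)
      using () renaming (product to Y∏)
    open SemiringSum semiring using (sum-cong-≋)

    substitute-∑-multi : ∀ {e} (f : Vec (Fin M) e → Y.Poly) →
      substitute σ (∑-multi {d} {M} f) ≋ multiSum (λ v → substitute σ (f v))
    substitute-∑-multi {zero}  f = ≋-refl
    substitute-∑-multi {suc e} f = ≋-trans
      (reflexive (substitute-∑ σ λ i → ∑-multi {d} {M} λ v → f (i ∷ v)))
      (sum-cong-≋ λ i → substitute-∑-multi λ v → f (i ∷ v))

    substitute-toPoly : (B : Tensor d M) →
      substitute σ (toPoly B) ≋
      multiSum (λ w → con (B w) ⊙ ∏ λ j → σ (j , lookup w j))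
    substitute-toPoly B = ≋-trans (substitute-∑-multi λ w → Y.con (B w) Y.⊙ Y∏ λ j → Y.var (j , lookup w j))
      (multiSum-cong λ w → ⊙-cong ≋-refl (reflexive (substitute-∏ σ λ j → Y.var (j , lookup w j))))

  -- Splitting a product tensor along a sum of simple tensors.

  module _ {d N M P : ℕ} (π₁ : Fin P → Fin N) (π₂ : Fin P → Fin M) where

    open PolyLemmas (Variable d P)
    private module Y = Polynomial (Variable d M)
    open SemiringSum semiring using (sum-cong-≋; *-distribʳ-sum)
    open CommutativeMonoidSum *-commutativeMonoid using ()
      renaming (∑-distrib-+ to ∏-distrib-⊙; sum-cong-≋ to ∏-cong)
    open import Relation.Binary.Reasoning.Setoid setoid

    -- With `p` read as the pair of `π₁ p` and `π₂ p`, these are the coefficients of the form that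
    -- replaces the variable `(j , b)`: the form `ℓ j` spread over the indices above `b`. Zero
    -- coefficients are kept, so every form has exactly `P` terms.
    contractionCoefficient : (Fin d → Fin N → Carrier) → Fin d → Fin M → Fin P → Carrier
    contractionCoefficient ℓ j b p = if does (π₂ p ≟ b) then ℓ j (π₁ p) else 0#

    contraction : (Fin d → Fin N → Carrier) → Variable d M → Poly
    contraction ℓ (j , b) = ∑ λ p → con (contractionCoefficient ℓ j b p) ⊙ var (j , p)

    contraction-select : ∀ ℓ j b → contraction ℓ (j , b) ≋
      ∑ λ p → select (π₂ p) b (con (ℓ j (π₁ p)) ⊙ var (j , p))
    contraction-select ℓ j b = sum-cong-≋ λ p → term p
      where
      term : ∀ p → con (contractionCoefficient ℓ j b p) ⊙ var (j , p) ≋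
        select (π₂ p) b (con (ℓ j (π₁ p)) ⊙ var (j , p))
      term p with does (π₂ p ≟ b)
      ... | true  = ≋-refl
      ... | false = ⊙-zeroˡ _

    contract-toPoly : ∀ ℓ (B : Tensor d M) → substitute (contraction ℓ) (toPoly B) ≋
      multiSum (λ v → con (B (map π₂ v)) ⊙ ∏ λ j → con (ℓ j (π₁ (lookup v j))) ⊙ var (j , lookup v j))
    contract-toPoly ℓ B = ≋-trans (substitute-toPoly (contraction ℓ) B)
      (multiSum-substitute π₂ (con ∘ B) (λ j p → con (ℓ j (π₁ p)) ⊙ var (j , p))
        (λ j b → contraction ℓ (j , b)) (contraction-select ℓ))

    -- Expanding `A` splits each coefficient of `W` into `ρ` parts. In the part of `ℓ i` the scalars
    -- are distributed over the modes, one per variable, which is the polynomial of `B` with its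
    -- variables replaced by `contraction (ℓ i)`.
    toPoly-decomposition : ∀ {ρ} (A : Tensor d N) (B : Tensor d M) (W : Tensor d P) →
      (∀ v → W v ≈ A (map π₁ v) *ᶠ B (map π₂ v)) →
      (ℓ : Fin ρ → Fin d → Fin N → Carrier) →
      (∀ v → A v ≈ sumᶠ λ i → simple (ℓ i) v) →
      toPoly W ≋ ∑ λ i → substitute (contraction (ℓ i)) (toPoly B)
    toPoly-decomposition {ρ} A B W W≈ ℓ A≈ = begin
      toPoly W
        ≈⟨ ∑-multi≋multiSum {d} {P} (λ v → con (W v) ⊙ ∏ λ j → var (j , lookup v j)) ⟩
      multiSum (λ v → con (W v) ⊙ ∏ λ j → var (j , lookup v j))
        ≈⟨ multiSum-cong term ⟩
      multiSum (λ v → ∑ λ i → summand i v)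
        ≈⟨ multiSum-∑ summand ⟩
      (∑ λ i → multiSum (summand i))
        ≈⟨ sum-cong-≋ (λ i → contract-toPoly (ℓ i) B) ⟨
      (∑ λ i → substitute (contraction (ℓ i)) (toPoly B)) ∎
      where
      summand : Fin ρ → Vec (Fin P) d → Poly
      summand i v = con (B (map π₂ v)) ⊙ ∏ λ j → con (ℓ i j (π₁ (lookup v j))) ⊙ var (j , lookup v j)

      module _ (v : Vec (Fin P) d) where
        b x : Poly
        b = con (B (map π₂ v))
        x = ∏ λ j → var (j , lookup v j)

        simpleTerm : ∀ i → con (simple (ℓ i) (map π₁ v)) ⊙ x ≋
          ∏ λ j → con (ℓ i j (π₁ (lookup v j))) ⊙ var (j , lookup v j)
        simpleTerm i = begin
          con (simple (ℓ i) (map π₁ v)) ⊙ x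
            ≈⟨ ⊙-cong (con-product λ j → ℓ i j (lookup (map π₁ v) j)) ≋-refl ⟩
          ∏ (λ j → con (ℓ i j (lookup (map π₁ v) j))) ⊙ x
            ≈⟨ ∏-distrib-⊙ (λ j → con (ℓ i j (lookup (map π₁ v) j))) (λ j → var (j , lookup v j)) ⟨
          ∏ (λ j → con (ℓ i j (lookup (map π₁ v) j)) ⊙ var (j , lookup v j))
            ≈⟨ ∏-cong (λ j → ⊙-cong (reflexive (≡.cong (con ∘ ℓ i j) (lookup-map j π₁ v))) ≋-refl) ⟩
          ∏ (λ j → con (ℓ i j (π₁ (lookup v j))) ⊙ var (j , lookup v j)) ∎

        term : con (W v) ⊙ x ≋ ∑ λ i → summand i v
        term = begin
          con (W v) ⊙ x
            -- The coefficient of `B` moves to the front, where it is a common factor of the sum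
            -- over `i`.
            ≈⟨ ⊙-cong (≋-trans (con-cong (K.trans (W≈ v) (K.trans (K.*-congʳ (A≈ (map π₁ v))) (K.*-comm _ _)))) (con-* _ _)) ≋-refl ⟩
          (b ⊙ con (sumᶠ λ i → simple (ℓ i) (map π₁ v))) ⊙ x
            ≈⟨ ⊙-assoc _ _ _ ⟩
          b ⊙ (con (sumᶠ λ i → simple (ℓ i) (map π₁ v)) ⊙ x)
            ≈⟨ ⊙-cong ≋-refl (⊙-cong (con-sum λ i → simple (ℓ i) (map π₁ v)) ≋-refl) ⟩
          b ⊙ (∑ (λ i → con (simple (ℓ i) (map π₁ v))) ⊙ x)
            ≈⟨ ⊙-cong ≋-refl (*-distribʳ-sum x λ i → con (simple (ℓ i) (map π₁ v))) ⟩
          b ⊙ (∑ λ i → con (simple (ℓ i) (map π₁ v)) ⊙ x)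
            ≈⟨ ⊙-cong ≋-refl (sum-cong-≋ simpleTerm) ⟩
          b ⊙ (∑ λ i → ∏ λ j → con (ℓ i j (π₁ (lookup v j))) ⊙ var (j , lookup v j))
            ≈⟨ SemiringSum.*-distribˡ-sum semiring b (λ i → ∏ λ j → con (ℓ i j (π₁ (lookup v j))) ⊙ var (j , lookup v j)) ⟩
          (∑ λ i → summand i v) ∎

  -- Extending circuits while counting wires.

  module CircuitExtension (V : Set) where

    open PolyLemmas V using
      (Poly; con; var; _⊕_; _⊙_; _≋_; ≋-refl; ≋-trans; ⊕-cong; ⊙-cong; reflexive; ∑)
    open ArithmeticCircuit V

    infix 4 _⊑_
    -- Only the presence of the old values matters, as new wires may start at any vertex that
    -- carries them. Being a record lets both circuits be inferred from the type.
    record _⊑_ {N N′} (C : Circuit N) (C′ : Circuit N′) : Set c where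
      constructor embed
      field
        image : ∀ i → ∃[ i′ ] value C′ i′ ≡ value C i
    open _⊑_

    ⊑-refl : ∀ {N} {C : Circuit N} → C ⊑ C
    ⊑-refl = embed λ i → i , ≡.refl

    ⊑-trans : ∀ {N₁ N₂ N₃} {C₁ : Circuit N₁} {C₂ : Circuit N₂} {C₃ : Circuit N₃} →
      C₁ ⊑ C₂ → C₂ ⊑ C₃ → C₁ ⊑ C₃
    ⊑-trans C₁⊑C₂ C₂⊑C₃ = embed λ i →
      let i′ , e′ = image C₁⊑C₂ i ; i″ , e″ = image C₂⊑C₃ i′ in i″ , ≡.trans e″ e′

    ⊑-▷ : ∀ {N} {C : Circuit N} {g : Vertex N} → C ⊑ C ▷ g
    ⊑-▷ = embed λ i → suc i , ≡.refl

    Computes : ∀ {N} → Circuit N → Poly → Set (c ⊔ ℓ₁)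
    Computes C p = ∃[ i ] value C i ≋ p

    Computes-⊑ : ∀ {N N′} {C : Circuit N} {C′ : Circuit N′} {p} →
      C ⊑ C′ → Computes C p → Computes C′ p
    Computes-⊑ C⊑C′ (i , e) =
      let i′ , e′ = image C⊑C′ i in i′ , ≋-trans (reflexive e′) e

    -- The cost is an equality because `ComputedInSize` asks for a circuit of exactly the given
    -- size. The index set `I` allows many polynomials to be computed by one extension.
    record Extension {N} (C : Circuit N) (cost : ℕ) {I : Set} (f : I → Poly) : Set (c ⊔ ℓ₁) where
      constructor extension
      field
        {order}  : ℕ
        circuit  : Circuit order
        extends  : C ⊑ circuit
        size≡    : size circuit ≡ size C ℕ.+ cost
        computes : ∀ i → Computes circuit (f i)

    append : ∀ {N p} (C : Circuit N) (g : Vertex N) → vertexValue (value C) g ≋ p →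
      Extension C (fanIn g) {⊤} λ _ → p
    append C g e = extension (C ▷ g) ⊑-▷ ≡.refl λ _ → zero , e

    -- The members are appended one after another, so `step` has to work over any circuit that
    -- already extends `C`.
    extendFamily : ∀ {N} (C : Circuit N) {cost n} {I : Set} (f : Fin n → I → Poly) →
      (∀ i {N′} (C′ : Circuit N′) → C ⊑ C′ → Extension C′ cost (f i)) →
      Extension C (n ℕ.* cost) (uncurry f)
    extendFamily C {n = zero}  f step =
      extension C ⊑-refl (≡.sym (ℕ.+-identityʳ _)) λ ()
    extendFamily C {cost} {suc n} f step = extension E₂.circuit
      (⊑-trans E₁.extends E₂.extends)
      (≡.trans E₂.size≡ (≡.trans (≡.cong (ℕ._+ n ℕ.* cost) E₁.size≡) (ℕ.+-assoc (size C) cost _)))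
      λ { (zero  , x) → Computes-⊑ E₂.extends (E₁.computes x)
        ; (suc i , x) → E₂.computes (i , x) }
      where
      module E₁ = Extension (step zero C ⊑-refl)
      module E₂ = Extension
        (extendFamily E₁.circuit (f ∘ suc) λ i C′ le → step (suc i) C′ (⊑-trans E₁.extends le))

    -- One addition gate suffices: the coefficients are the labels of its `n` wires.
    extendLinear : ∀ {N} (C : Circuit N) {n} (a : Fin n → Carrier) (f : Fin n → Poly) →
      (∀ i → Computes C (f i)) → Extension C n {⊤} λ _ → ∑ λ i → con (a i) ⊙ f i
    -- A gate has at least one wire, so the empty sum is a constant vertex, which costs nothing.
    extendLinear C {zero}  a f has = append C (constant 0#) ≋-refl
    extendLinear C {suc n} a f has = ≡.subst (λ k → Extension C k {⊤} λ _ → ∑ λ i → con (a i) ⊙ f i)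
      (≡.cong suc (length-tabulate (wire ∘ suc)))
      (append C (gate plus (wire zero ∷ List.tabulate (wire ∘ suc)))
        (⊕-cong (transmit-wire zero) (foldr-tabulate suc)))
      where
      wire : Fin (suc n) → Wire _
      wire i = a i , proj₁ (has i)

      transmit-wire : ∀ i → transmit (value C) (wire i) ≋ con (a i) ⊙ f i
      transmit-wire i = ⊙-cong ≋-refl (proj₂ (has i))

      foldr-tabulate : ∀ {k} (ι : Fin k → Fin (suc n)) →
        foldr (λ w p → transmit (value C) w ⊕ p) (con 0#) (List.tabulate (wire ∘ ι)) ≋
        ∑ λ i → con (a (ι i)) ⊙ f (ι i)
      foldr-tabulate {zero}  ι = ≋-refl
      foldr-tabulate {suc k} ι = ⊕-cong (transmit-wire (ι zero)) (foldr-tabulate (ι ∘ suc))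

  -- Substitution carried out on circuits.

  module _ {V V′ : Set} where

    private
      module A = ArithmeticCircuit V
    open PolyLemmas V′ using (Poly; con; _⊕_; _⊙_; _≋_; ≋-refl; ⊕-cong; ⊙-cong)
    open CircuitExtension V′
    open ArithmeticCircuit V′

    module _ (σ : V → Poly) where

      module _ {M N} (C : A.Circuit M) (D : Circuit N)
        (has : ∀ i → Computes D (substitute σ (A.value C i))) where

        rewire : A.Wire M → Wire N
        rewire (a , i) = a , proj₁ (has i)

        transmit-rewire : ∀ w → transmit (value D) (rewire w) ≋
          substitute σ (A.transmit (A.value C) w)
        transmit-rewire (a , i) = ⊙-cong ≋-refl (proj₂ (has i))

        translateOp : A.Op → Op
        translateOp A.plus  = plus
        translateOp A.times = times

        vertexValue-rewire : ∀ o ws →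
          vertexValue (value D) (gate (translateOp o) (List⁺.map rewire ws)) ≋
          substitute σ (A.vertexValue (A.value C) (A.gate o ws))
        vertexValue-rewire A.plus  (w ∷ ws) = go (w ∷ ws)
          where
          go : ∀ ws → foldr (λ w p → transmit (value D) w ⊕ p) (con 0#) (List.map rewire ws) ≋
            substitute σ (foldr (λ w p → Polynomial._⊕_ (A.transmit (A.value C) w) p) (Polynomial.con 0#) ws)
          go []       = ≋-refl
          go (w ∷ ws) = ⊕-cong (transmit-rewire w) (go ws)
        vertexValue-rewire A.times (w ∷ ws) = go (w ∷ ws)
          where
          go : ∀ ws → foldr (λ w p → transmit (value D) w ⊙ p) (con 1#) (List.map rewire ws) ≋
            substitute σ (foldr (λ w p → Polynomial._⊙_ (A.transmit (A.value C) w) p) (Polynomial.con 1#) ws)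
          go []       = ≋-refl
          go (w ∷ ws) = ⊙-cong (transmit-rewire w) (go ws)

      -- An input vertex of C is replaced by the vertex of D that computes its
      -- substitute, not by a new one: vertices that no wire leaves are free,
      -- so the number of inputs of C is not bounded by its size.
      extendSubstitute : ∀ {M N} (C : A.Circuit M) (D : Circuit N) →
        (∀ x → Computes D (σ x)) →
        Extension D (A.size C) λ i → substitute σ (A.value C i)
      extendSubstitute A.[] D has =
        extension D ⊑-refl (≡.sym (ℕ.+-identityʳ _)) λ ()
      extendSubstitute (C A.▷ A.constant a) D has =
        let extension D′ D⊑D′ size≡ has′ = extendSubstitute C D has in
        extension (D′ ▷ constant a) (⊑-trans D⊑D′ ⊑-▷)
          (≡.trans (≡.cong (ℕ._+ 0) size≡) (ℕ.+-assoc (size D) (A.size C) 0))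
          λ { zero    → zero , ≋-refl
            ; (suc i) → Computes-⊑ ⊑-▷ (has′ i) }
      extendSubstitute (C A.▷ A.input x) D has =
        let extension D′ D⊑D′ size≡ has′ = extendSubstitute C D has in
        extension D′ D⊑D′
          (≡.trans size≡ (≡.cong (size D ℕ.+_) (≡.sym (ℕ.+-identityʳ _))))
          λ { zero    → Computes-⊑ D⊑D′ (has x)
            ; (suc i) → has′ i }
      extendSubstitute (C A.▷ A.gate o ws) D has =
        let extension D′ D⊑D′ size≡ has′ = extendSubstitute C D has in
        extension (D′ ▷ gate (translateOp C D′ has′ o) (List⁺.map (rewire C D′ has′) ws))
          (⊑-trans D⊑D′ ⊑-▷)
          (≡.trans
            (≡.cong₂ ℕ._+_ size≡ (≡.cong suc (length-map (rewire C D′ has′) (List⁺.tail ws))))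
            (ℕ.+-assoc (size D) (A.size C) (List⁺.length ws)))
          λ { zero    → zero , vertexValue-rewire C D′ has′ o ws
            ; (suc i) → Computes-⊑ ⊑-▷ (has′ i) }

  -- The circuit for a product tensor.

  module _ {d P : ℕ} where

    open PolyLemmas (Variable d P)
    open ArithmeticCircuit (Variable d P)
    open CircuitExtension (Variable d P)

    -- Size counts wires only, so all `d * P` variables are available for free; they are shared by
    -- all later copies.
    inputs : Extension [] 0 var
    inputs = extension E.circuit (embed λ ()) (≡.trans E.size≡ (≡.trans (≡.cong (d ℕ.*_) (ℕ.*-zeroʳ P)) (ℕ.*-zeroʳ d)))
      λ { (j , p) → E.computes (j , p , tt) }
      where
      family : Extension [] (d ℕ.* (P ℕ.* 0)) (uncurry λ j → uncurry λ p (_ : ⊤) → var (j , p))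
      family = extendFamily [] (λ j → uncurry λ p _ → var (j , p)) λ j C′ _ →
        extendFamily C′ (λ p _ → var (j , p)) λ p C″ _ → append C″ (input (j , p)) ≋-refl
      module E = Extension family

  module _ {d N M P : ℕ} (π₁ : Fin P → Fin N) (π₂ : Fin P → Fin M) where

    open PolyLemmas (Variable d P)
    open ArithmeticCircuit (Variable d P)
    open CircuitExtension (Variable d P)
    open SemiringSum semiring using (sum-cong-≋)
    private module A = ArithmeticCircuit (Variable d M)

    -- There are `d * M` linear forms with `P` wires each; a copy of `C` is then fed by these forms
    -- in place of its inputs.
    extendContraction : ∀ {N₀ K} (D : Circuit N₀) → (∀ x → Computes D (var x)) →
      (C : A.Circuit K) (out : Fin K) (ℓ : Fin d → Fin N → Carrier) →
      Extension D (d ℕ.* (M ℕ.* P) ℕ.+ A.size C) {⊤}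
        λ _ → substitute (contraction π₁ π₂ ℓ) (A.value C out)
    extendContraction D has C out ℓ = extension E₂.circuit (⊑-trans E₁.extends E₂.extends)
      (≡.trans E₂.size≡ (≡.trans (≡.cong (ℕ._+ A.size C) E₁.size≡) (ℕ.+-assoc (size D) _ _)))
      λ _ → E₂.computes out
      where
      forms : Extension D (d ℕ.* (M ℕ.* P)) (uncurry λ j → uncurry λ b (_ : ⊤) → contraction π₁ π₂ ℓ (j , b))
      forms = extendFamily D (λ j → uncurry λ b _ → contraction π₁ π₂ ℓ (j , b)) λ j D′ D⊑D′ →
        extendFamily D′ (λ b _ → contraction π₁ π₂ ℓ (j , b)) λ b D″ D′⊑D″ →
        extendLinear D″ (contractionCoefficient π₁ π₂ ℓ j b) (λ p → var (j , p)) λ p →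
        Computes-⊑ (⊑-trans D⊑D′ D′⊑D″) (has (j , p))
      module E₁ = Extension forms
      module E₂ = Extension (extendSubstitute (contraction π₁ π₂ ℓ) C E₁.circuit
        λ x → E₁.computes (proj₁ x , proj₂ x , tt))

    -- One copy of the circuit for `B` is built per simple tensor; the final summand `ρ` of the size
    -- counts the wires of the gate that adds their outputs.
    ComputedInSize-⊗ : ∀ {ρ S} (A : Tensor d N) (B : Tensor d M) (W : Tensor d P) →
      (∀ v → W v ≈ A (map π₁ v) *ᶠ B (map π₂ v)) →
      SumOfSimple A ρ → ComputedInSize B S →
      ComputedInSize W (ρ ℕ.* (d ℕ.* (M ℕ.* P) ℕ.+ S) ℕ.+ ρ)
    ComputedInSize-⊗ {ρ} {S} A B W W≈ (ℓ , A≈) (K , C , out , C≋B , size≡S) =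
      E₂.order , E₂.circuit , proj₁ (E₂.computes tt) ,
      ≋-trans (proj₂ (E₂.computes tt)) (≋-trans (sum-cong-≋ summand) (≋-sym (toPoly-decomposition π₁ π₂ A B W W≈ ℓ A≈))) ,
      ≡.trans E₂.size≡ (≡.cong (ℕ._+ ρ) (≡.trans E₁.size≡
        (≡.cong₂ (λ x y → x ℕ.+ ρ ℕ.* (d ℕ.* (M ℕ.* P) ℕ.+ y)) E₀.size≡ size≡S)))
      where
      module E₀ = Extension inputs
      f : Fin ρ → Poly
      f i = substitute (contraction π₁ π₂ (ℓ i)) (A.value C out)
      module E₁ = Extension (extendFamily E₀.circuit (λ i (_ : ⊤) → f i) λ i D E₀⊑D →
        extendContraction D (λ x → Computes-⊑ E₀⊑D (E₀.computes x)) C out (ℓ i))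
      module E₂ = Extension (extendLinear E₁.circuit (λ _ → 1#) f λ i → E₁.computes (i , tt))
      summand : ∀ i → con 1# ⊙ f i ≋ substitute (contraction π₁ π₂ (ℓ i)) (toPoly B)
      summand i = ≋-trans (⊙-identityˡ _) (substitute-cong (contraction π₁ π₂ (ℓ i)) C≋B)

  -- Powers of a Kronecker product as Kronecker products of powers.

  module _ {n m : ℕ} where

    -- By induction on `k`: the step exchanges the two middle factors, and what remains is that
    -- `quotient` and `remainder` undo the `combine` in the index maps.
    ⊗^-distrib-⊗ : ∀ {d} (T : Tensor d n) (U : Tensor d m) k v →
      ((T ⊗ U) ⊗^ k) v ≈ (T ⊗^ k) (map (leftIndex n m k) v) *ᶠ (U ⊗^ k) (map (rightIndex n m k) v)
    ⊗^-distrib-⊗ T U zero    v = K.sym (K.*-identityˡ 1#)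
    ⊗^-distrib-⊗ T U (suc k) v = K.trans (K.*-congˡ (⊗^-distrib-⊗ T U k (map r v)))
      (K.trans (interchange _ _ _ _) (K.reflexive (≡.cong₂ _*ᶠ_
        (≡.cong₂ (λ a b → T a *ᶠ (T ⊗^ k) b)
          (≡.trans (≡.sym (map-∘ _ q v)) (≡.sym (map-quotient-combine (quotient {n} m ∘ q) (leftIndex n m k ∘ r) v)))
          (≡.trans (≡.sym (map-∘ _ r v)) (≡.sym (map-remainder-combine {x = n} (quotient {n} m ∘ q) (leftIndex n m k ∘ r) v))))
        (≡.cong₂ (λ a b → U a *ᶠ (U ⊗^ k) b)
          (≡.trans (≡.sym (map-∘ _ q v)) (≡.sym (map-quotient-combine (remainder {n} m ∘ q) (rightIndex n m k ∘ r) v)))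
          (≡.trans (≡.sym (map-∘ _ r v)) (≡.sym (map-remainder-combine {x = m} (remainder {n} m ∘ q) (rightIndex n m k ∘ r) v)))))))
      where
      open import Algebra.Properties.CommutativeSemigroup K.*-commutativeSemigroup using (interchange)
      q : Fin ((n ℕ.* m) ℕ.^ suc k) → Fin (n ℕ.* m)
      q = quotient {n ℕ.* m} ((n ℕ.* m) ℕ.^ k)
      r : Fin ((n ℕ.* m) ℕ.^ suc k) → Fin ((n ℕ.* m) ℕ.^ k)
      r = remainder {n ℕ.* m} ((n ℕ.* m) ℕ.^ k)

-- Estimates for natural numbers with roots cleared.

module PowerBounds where

  open import Data.Nat.Base
  open import Data.Nat.Properties

  ^-distribʳ-* : ∀ m n o → (m * n) ^ o ≡ m ^ o * n ^ o
  ^-distribʳ-* m n zero    = ≡.refl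
  ^-distribʳ-* m n (suc o) =
    ≡.trans (≡.cong (m * n *_) (^-distribʳ-* m n o)) (interchange m n (m ^ o) (n ^ o))
    where
    interchange : ∀ a b c d → a * b * (c * d) ≡ a * c * (b * d)
    interchange = solve-∀

  ^-cancelˡ-≤ : ∀ o .{{_ : NonZero o}} {m n} → m ^ o ≤ n ^ o → m ≤ n
  ^-cancelˡ-≤ o {m} {n} le = ≮⇒≥ λ n<m → <⇒≱ (^-monoˡ-< o n<m) le

  -- Taking D-th roots gives a + b in place of 2 * (a + b); the factor 2 avoids the roots.
  +-^-bound : ∀ D x y {a b Z} → x ^ D ≤ a ^ D * Z → y ^ D ≤ b ^ D * Z →
    (x + y) ^ D ≤ (2 * (a + b)) ^ D * Z
  +-^-bound D x y {a} {b} {Z} hx hy with ≤-total x y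
  ... | inj₁ x≤y = begin
    (x + y) ^ D               ≤⟨ ^-monoˡ-≤ D (+-monoˡ-≤ y x≤y) ⟩
    (y + y) ^ D               ≡⟨ ≡.cong (λ z → (y + z) ^ D) (+-identityʳ y) ⟨
    (2 * y) ^ D               ≡⟨ ^-distribʳ-* 2 y D ⟩
    2 ^ D * y ^ D             ≤⟨ *-monoʳ-≤ (2 ^ D) (≤-trans hy (*-monoˡ-≤ Z (^-monoˡ-≤ D (m≤n+m b a)))) ⟩
    2 ^ D * ((a + b) ^ D * Z) ≡⟨ *-assoc (2 ^ D) _ Z ⟨
    2 ^ D * (a + b) ^ D * Z   ≡⟨ ≡.cong (_* Z) (^-distribʳ-* 2 (a + b) D) ⟨
    (2 * (a + b)) ^ D * Z     ∎
    where open ≤-Reasoning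
  ... | inj₂ y≤x = begin
    (x + y) ^ D               ≤⟨ ^-monoˡ-≤ D (+-monoʳ-≤ x y≤x) ⟩
    (x + x) ^ D               ≡⟨ ≡.cong (λ z → (x + z) ^ D) (+-identityʳ x) ⟨
    (2 * x) ^ D               ≡⟨ ^-distribʳ-* 2 x D ⟩
    2 ^ D * x ^ D             ≤⟨ *-monoʳ-≤ (2 ^ D) (≤-trans hx (*-monoˡ-≤ Z (^-monoˡ-≤ D (m≤m+n a b)))) ⟩
    2 ^ D * ((a + b) ^ D * Z) ≡⟨ *-assoc (2 ^ D) _ Z ⟨
    2 ^ D * (a + b) ^ D * Z   ≡⟨ ≡.cong (_* Z) (^-distribʳ-* 2 (a + b) D) ⟨
    (2 * (a + b)) ^ D * Z     ∎
    where open ≤-Reasoning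

  -- Two nested uses of `+-^-bound`, first for the forms and the circuit and then for the extra `1`,
  -- give the second factor; `c₁` comes from the rank.
  sizeConstant : ℕ → ℕ → ℕ → ℕ
  sizeConstant d c₁ c₂ = c₁ * (2 * (2 * (d + c₂) + 1))

  -- The exponents of rank and circuit size are `A₁ / D` and `A₂ / D` over a common denominator, so
  -- `D≤A₁` and `D≤A₂` say that both are at least one. Every estimate is raised to the power `D`.
  module SizeBound
    {n m : ℕ} .{{_ : NonZero n}} .{{_ : NonZero m}} (d k D A₁ A₂ : ℕ) {c₁ c₂ ρ S : ℕ}
    (D≤A₁ : D ≤ A₁) (D≤A₂ : D ≤ A₂)
    (ρ-bound : ρ ^ D ≤ c₁ ^ D * n ^ (A₁ * k)) (S-bound : S ^ D ≤ c₂ ^ D * m ^ (A₂ * k))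
    where

    open ≤-Reasoning

    private
      -- The `D`-th power of n^k m^((1 + A₂/D) k), a common bound for the forms, the circuit and the
      -- constant one.
      Z : ℕ
      Z = n ^ (D * k) * m ^ ((D + A₂) * k)

      pow-pow : ∀ x → (x ^ k) ^ D ≡ x ^ (D * k)
      pow-pow x = ≡.trans (^-*-assoc x k D) (≡.cong (x ^_) (*-comm k D))

      pow-+ : ∀ x a b → x ^ (a * k) * x ^ (b * k) ≡ x ^ ((a + b) * k)
      pow-+ x a b = ≡.trans (≡.sym (^-distribˡ-+-* x (a * k) (b * k)))
                            (≡.cong (x ^_) (≡.sym (*-distribʳ-+ k a b)))

    -- Of the two factors `m ^ k`, one is enlarged to m^((A₂/D) k) by `D≤A₂`.
    forms-bound : (d * (m ^ k * (n * m) ^ k)) ^ D ≤ d ^ D * Z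
    forms-bound = begin
      (d * (m ^ k * (n * m) ^ k)) ^ D
        ≡⟨ ≡.trans (^-distribʳ-* d _ D) (≡.cong (d ^ D *_) (^-distribʳ-* (m ^ k) _ D)) ⟩
      d ^ D * ((m ^ k) ^ D * ((n * m) ^ k) ^ D)
        ≡⟨ ≡.cong₂ (λ x y → d ^ D * (x * y)) (pow-pow m)
             (≡.trans (pow-pow (n * m)) (^-distribʳ-* n m (D * k))) ⟩
      d ^ D * (m ^ (D * k) * (n ^ (D * k) * m ^ (D * k)))
        ≤⟨ *-monoʳ-≤ (d ^ D) (*-monoˡ-≤ (n ^ (D * k) * m ^ (D * k)) (^-monoʳ-≤ m (*-monoˡ-≤ k D≤A₂))) ⟩
      d ^ D * (m ^ (A₂ * k) * (n ^ (D * k) * m ^ (D * k)))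
        ≡⟨ ≡.cong (d ^ D *_) (rearrange (m ^ (A₂ * k)) (n ^ (D * k)) (m ^ (D * k))) ⟩
      d ^ D * (n ^ (D * k) * (m ^ (D * k) * m ^ (A₂ * k)))
        ≡⟨ ≡.cong (λ x → d ^ D * (n ^ (D * k) * x)) (pow-+ m D A₂) ⟩
      d ^ D * Z ∎
      where
      rearrange : ∀ a b c → a * (b * c) ≡ b * (c * a)
      rearrange = solve-∀

    circuit-bound : S ^ D ≤ c₂ ^ D * Z
    circuit-bound = begin
      S ^ D                          ≤⟨ S-bound ⟩
      c₂ ^ D * m ^ (A₂ * k)          ≤⟨ *-monoʳ-≤ (c₂ ^ D) (^-monoʳ-≤ m (*-monoˡ-≤ k (m≤n+m A₂ D))) ⟩
      c₂ ^ D * m ^ ((D + A₂) * k)    ≤⟨ *-monoʳ-≤ (c₂ ^ D) (m≤n*m _ (n ^ (D * k)) {{m^n≢0 n (D * k)}}) ⟩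
      c₂ ^ D * Z                     ∎

    one-bound : 1 ^ D ≤ 1 ^ D * Z
    one-bound = m≤m*n (1 ^ D) Z {{m*n≢0 _ _ {{m^n≢0 n (D * k)}} {{m^n≢0 m ((D + A₂) * k)}}}}

    size-bound : (ρ * (d * (m ^ k * (n * m) ^ k) + S) + ρ) ^ D ≤
      sizeConstant d c₁ c₂ ^ D * (n * m) ^ ((A₁ + A₂) * k)
    size-bound = begin
      (ρ * Q + ρ) ^ D
        ≡⟨ ≡.cong (_^ D) (factor ρ Q) ⟩
      (ρ * (Q + 1)) ^ D
        ≡⟨ ^-distribʳ-* ρ (Q + 1) D ⟩
      ρ ^ D * (Q + 1) ^ D
        ≤⟨ *-mono-≤ ρ-bound (+-^-bound D Q 1 (+-^-bound D (d * (m ^ k * (n * m) ^ k)) S forms-bound circuit-bound) one-bound) ⟩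
      c₁ ^ D * n ^ (A₁ * k) * (e ^ D * Z)
        ≡⟨ rearrange (c₁ ^ D) (n ^ (A₁ * k)) (e ^ D) (n ^ (D * k)) _ ⟩
      c₁ ^ D * e ^ D * (n ^ (A₁ * k) * n ^ (D * k) * m ^ ((D + A₂) * k))
        ≡⟨ ≡.cong₂ (λ x y → x * (y * m ^ ((D + A₂) * k))) (^-distribʳ-* c₁ e D) (≡.sym (pow-+ n A₁ D)) ⟨
      sizeConstant d c₁ c₂ ^ D * (n ^ ((A₁ + D) * k) * m ^ ((D + A₂) * k))
        -- Both exponents rise to `A₁ + A₂`: that of `n` because `D ≤ A₂`, that of `m` because
        -- `D ≤ A₁`.
        ≤⟨ *-monoʳ-≤ (sizeConstant d c₁ c₂ ^ D) (*-mono-≤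
             (^-monoʳ-≤ n (*-monoˡ-≤ k (+-monoʳ-≤ A₁ D≤A₂)))
             (^-monoʳ-≤ m (*-monoˡ-≤ k (+-monoˡ-≤ A₂ D≤A₁)))) ⟩
      sizeConstant d c₁ c₂ ^ D * (n ^ ((A₁ + A₂) * k) * m ^ ((A₁ + A₂) * k))
        ≡⟨ ≡.cong (sizeConstant d c₁ c₂ ^ D *_) (^-distribʳ-* n m ((A₁ + A₂) * k)) ⟨
      sizeConstant d c₁ c₂ ^ D * (n * m) ^ ((A₁ + A₂) * k) ∎
      where
      Q e : ℕ
      Q = d * (m ^ k * (n * m) ^ k) + S
      e = 2 * (2 * (d + c₂) + 1)
      factor : ∀ r q → r * q + r ≡ r * (q + 1)
      factor = solve-∀
      rearrange : ∀ a b c u v → a * b * (c * (u * v)) ≡ a * c * (b * u * v)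
      rearrange = solve-∀

  -- The hypothesis says a/b ≤ a′/b′. The bound is raised to the power `b′`, the exponent enlarged,
  -- and the power `b` cancelled. It serves both to reach a common denominator and to weaken an
  -- exponent.
  ^-bound-rescale : ∀ {N c n a b a′ b′ k} .{{_ : NonZero n}} .{{_ : NonZero b}} →
    a * b′ ≤ a′ * b → N ^ b ≤ c ^ b * n ^ (a * k) → N ^ b′ ≤ c ^ b′ * n ^ (a′ * k)
  ^-bound-rescale {N} {c} {n} {a} {b} {a′} {b′} {k} ab′≤a′b h = ^-cancelˡ-≤ b (begin
    (N ^ b′) ^ b                        ≡⟨ swap N b′ b ⟩
    (N ^ b) ^ b′                        ≤⟨ ^-monoˡ-≤ b′ h ⟩
    (c ^ b * n ^ (a * k)) ^ b′          ≡⟨ ^-distribʳ-* (c ^ b) _ b′ ⟩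
    (c ^ b) ^ b′ * (n ^ (a * k)) ^ b′   ≡⟨ ≡.cong₂ _*_ (swap c b b′) (^-*-assoc n (a * k) b′) ⟩
    (c ^ b′) ^ b * n ^ (a * k * b′)     ≤⟨ *-monoʳ-≤ ((c ^ b′) ^ b) (^-monoʳ-≤ n exponents) ⟩
    (c ^ b′) ^ b * n ^ (a′ * k * b)     ≡⟨ ≡.cong ((c ^ b′) ^ b *_) (^-*-assoc n (a′ * k) b) ⟨
    (c ^ b′) ^ b * (n ^ (a′ * k)) ^ b   ≡⟨ ^-distribʳ-* (c ^ b′) _ b ⟨
    (c ^ b′ * n ^ (a′ * k)) ^ b         ∎)
    where
    open ≤-Reasoning
    swap : ∀ x y z → (x ^ y) ^ z ≡ (x ^ z) ^ y
    swap x y z = ≡.trans (^-*-assoc x y z) (≡.trans (≡.cong (x ^_) (*-comm y z)) (≡.sym (^-*-assoc x z y)))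
    right-comm : ∀ x y z → x * y * z ≡ x * z * y
    right-comm = solve-∀
    exponents : a * k * b′ ≤ a′ * k * b
    exponents = begin
      a * k * b′ ≡⟨ right-comm a k b′ ⟩
      a * b′ * k ≤⟨ *-monoˡ-≤ k ab′≤a′b ⟩
      a′ * b * k ≡⟨ right-comm a′ b k ⟩
      a′ * k * b ∎

  -- `PowBound` can only be used at fractions with natural numerator; the bound `1ℚ ≤ q` excludes a
  -- negative one.
  fraction-≥1 : ∀ q → 1ℚ ℚ.≤ q → ∃[ a ] ∃[ b ] Σ[ nz ∈ NonZero b ] (q ≡ ℚ._/_ (+ a) b {{nz}} × b ≤ a)
  fraction-≥1 q 1≤q with ℚ.↥ q in eq | ℚ.drop-*≤* 1≤q
  ... | + a      | le = a , ℚ.↧ₙ q , _ , ≡.trans (≡.sym (ℚ.↥p/↧p≡p q)) (≡.cong (ℚ._/ ℚ.↧ₙ q) eq) ,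
    ℤ.drop‿+≤+ (≡.subst₂ ℤ._≤_ (ℤ.*-identityˡ _) (ℤ.*-identityʳ _) le)
  ... | -[1+ a ] | ()

  -- In unnormalised rationals no common factors are cancelled, so the inequality there is literally
  -- the cross-multiplied one.
  fractions-+-≤ : ∀ a₁ b₁ a₂ b₂ a b .{{_ : NonZero b₁}} .{{_ : NonZero b₂}} .{{_ : NonZero b}} →
    (+ a₁ ℚ./ b₁) ℚ.+ (+ a₂ ℚ./ b₂) ℚ.≤ + a ℚ./ b →
    (a₁ * b₂ + a₂ * b₁) * b ≤ a * (b₁ * b₂)
  fractions-+-≤ a₁ b₁@(suc _) a₂ b₂@(suc _) a b@(suc _) le = drop (begin
    (+ a₁ ℚᵘ./ b₁) ℚᵘ.+ (+ a₂ ℚᵘ./ b₂)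
      ≃⟨ ℚᵘ.+-cong (ℚ.toℚᵘ-fromℚᵘ (+ a₁ ℚᵘ./ b₁)) (ℚ.toℚᵘ-fromℚᵘ (+ a₂ ℚᵘ./ b₂)) ⟨
    ℚ.toℚᵘ (+ a₁ ℚ./ b₁) ℚᵘ.+ ℚ.toℚᵘ (+ a₂ ℚ./ b₂)
      ≃⟨ ℚ.toℚᵘ-homo-+ (+ a₁ ℚ./ b₁) (+ a₂ ℚ./ b₂) ⟨
    ℚ.toℚᵘ ((+ a₁ ℚ./ b₁) ℚ.+ (+ a₂ ℚ./ b₂))
      ≤⟨ ℚ.toℚᵘ-mono-≤ le ⟩
    ℚ.toℚᵘ (+ a ℚ./ b)
      ≃⟨ ℚ.toℚᵘ-fromℚᵘ (+ a ℚᵘ./ b) ⟩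
    + a ℚᵘ./ b ∎)
    where
    open ℚᵘ.≤-Reasoning
    drop : (+ a₁ ℚᵘ./ b₁) ℚᵘ.+ (+ a₂ ℚᵘ./ b₂) ℚᵘ.≤ + a ℚᵘ./ b →
      (a₁ * b₂ + a₂ * b₁) * b ≤ a * (b₁ * b₂)
    drop (*≤* h) = ℤ.drop‿+≤+ (≡.subst₂ ℤ._≤_ lhs rhs h)
      where
      lhs : (+ a₁ ℤ.* + b₂ ℤ.+ + a₂ ℤ.* + b₁) ℤ.* + b ≡ + ((a₁ * b₂ + a₂ * b₁) * b)
      lhs = ≡.trans (≡.cong (ℤ._* + b) (≡.cong₂ ℤ._+_ (≡.sym (ℤ.pos-* a₁ b₂)) (≡.sym (ℤ.pos-* a₂ b₁))))
                    (≡.sym (ℤ.pos-* (a₁ * b₂ + a₂ * b₁) b))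
      rhs : + a ℤ.* + (b₁ * b₂) ≡ + (a * (b₁ * b₂))
      rhs = ≡.sym (ℤ.pos-* a (b₁ * b₂))

open PowerBounds

-- From rational bounds to real exponents.

<-fromℚ : ∀ x {a} → ℝ.U x a → x Real.< Real.fromℚ a
<-fromℚ x Uxa = let p , p<a , Uxp = ℝ.U-open x Uxa in p , Uxp , p<a

U-<-fromℚ : ∀ x {a} → x Real.< Real.fromℚ a → ℝ.U x a
U-<-fromℚ x (p , Uxp , p<a) = ℝ.U-closed x p<a Uxp

-- If `a` were below one, it would lie in both cuts of `x`.
1≤U : ∀ x {a} → Real.1ℝ Real.≤ x → ℝ.U x a → 1ℚ ℚ.≤ a
1≤U x {a} 1≤x Uxa = ℚ.≮⇒≥ λ a<1 → ℚ.<-irrefl ≡.refl (ℝ.disjoint x (1≤x a a<1) Uxa)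

PowBound-⊗ : ∀ {n m} .{{_ : NonZero n}} .{{_ : NonZero m}} d {k c₁ c₂ ρ S} β γ {a b q} →
  1ℚ ℚ.≤ a → 1ℚ ℚ.≤ b → ℝ.U β a → ℝ.U γ b → a ℚ.+ b ℚ.≤ q →
  Real.PowBound c₁ n β k ρ → Real.PowBound c₂ m γ k S →
  Real.PowBound (sizeConstant d c₁ c₂) (n ℕ.* m) (Real.fromℚ q) k
    (ρ ℕ.* (d ℕ.* (m ℕ.^ k ℕ.* (n ℕ.* m) ℕ.^ k) ℕ.+ S) ℕ.+ ρ)
PowBound-⊗ {n} {m} d {k} β γ {a} {b} {q} 1≤a 1≤b Uβa Uγb a+b≤q ρ-bound S-bound a′ b′ q<a′/b′ =
  let a₁ , b₁ , b₁≢0 , a≡ , b₁≤a₁ = fraction-≥1 a 1≤a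
      a₂ , b₂ , b₂≢0 , b≡ , b₂≤a₂ = fraction-≥1 b 1≤b
      D = b₁ ℕ.* b₂
      instance
        _ = b₁≢0
        _ = b₂≢0
        _ = ℕ.m*n≢0 b₁ b₂
        _ = ℕ.m*n≢0 n m
  in ^-bound-rescale {a = a₁ ℕ.* b₂ ℕ.+ a₂ ℕ.* b₁} {b = D} {a′ = a′} {b′ = b′}
       -- The exponent (a₁ b₂ + a₂ b₁) / D equals a + b, which is at most `q` and hence at most
       -- a′/b′.
       (fractions-+-≤ a₁ b₁ a₂ b₂ a′ b′
         (ℚ.≤-trans (≡.subst₂ (λ u v → u ℚ.+ v ℚ.≤ q) a≡ b≡ a+b≤q) (ℚ.<⇒≤ q<a′/b′)))
       (SizeBound.size-bound d k D (a₁ ℕ.* b₂) (a₂ ℕ.* b₁)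
         (ℕ.*-monoˡ-≤ b₂ b₁≤a₁)
         (ℕ.≤-trans (ℕ.≤-reflexive (ℕ.*-comm b₁ b₂)) (ℕ.*-monoˡ-≤ b₁ b₂≤a₂))
         (^-bound-rescale {a = a₁} {b = b₁} {a′ = a₁ ℕ.* b₂} {b′ = D}
           (ℕ.≤-reflexive (≡.trans (≡.cong (a₁ ℕ.*_) (ℕ.*-comm b₁ b₂)) (≡.sym (ℕ.*-assoc a₁ b₂ b₁))))
           (ρ-bound a₁ b₁ (≡.subst (ℝ.U β) a≡ Uβa)))
         (^-bound-rescale {a = a₂} {b = b₂} {a′ = a₂ ℕ.* b₁} {b′ = D}
           (ℕ.≤-reflexive (≡.sym (ℕ.*-assoc a₂ b₁ b₂)))
           (S-bound a₂ b₂ (≡.subst (ℝ.U γ) b≡ Uγb))))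

theorem5 : ∀ {c ℓ₁ ℓ₂} (F : HeytingField c ℓ₁ ℓ₂) →
    let open Over F
        open Real
    in ∀ {d n m : ℕ} .{{_ : NonZero n}} .{{_ : NonZero m}}
       (T : Tensor d n) (U : Tensor d m) (r s : ℝ) →
       ω T ≐ r → 1ℝ ≤ r →
       η U ≐ s → 1ℝ ≤ s →
       η (T ⊗ U) ≲ (r + s)
theorem5 F {d} {n} {m} T U r s (_ , ω≤r) 1≤r (_ , η≤s) 1≤s y (q , (a , b , Ura , Usb , a+b≤q) , Lyq) =
  -- The premise that r + s lies below `y` has been unpacked into rationals with r < a, s < b and a
  -- + b ≤ q < y.
  let 1≤a = 1≤U r 1≤r Ura
      1≤b = 1≤U s 1≤s Usb
      -- The infimum gives an admissible exponent below `a`, so the rank bound may be used at `a`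
      -- itself; likewise for the circuit size at `b`.
      β , (_ , c₁ , K₁ , ranks) , β<a = ω≤r (Real.fromℚ a) (<-fromℚ r Ura)
      γ , (_ , c₂ , K₂ , sizes) , γ<b = η≤s (Real.fromℚ b) (<-fromℚ s Usb)
      0≤q = ℚ.≤-trans (ℚ.+-mono-≤ (ℚ.≤-trans 0≤1 1≤a) (ℚ.≤-trans 0≤1 1≤b)) a+b≤q
  -- The rational `q` is itself an admissible exponent for `T ⊗ U`, and it lies below `y` because
  -- the lower cut of `y` is open.
  in Real.fromℚ q ,
     ( (λ p p<0 → ℚ.<-≤-trans p<0 0≤q)
     , sizeConstant d c₁ c₂ , K₁ ℕ.⊔ K₂ , λ k K≤k →
       let ρ , rank , ρ-bound = ranks k (ℕ.m⊔n≤o⇒m≤o K₁ K₂ K≤k)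
           S , size , S-bound = sizes k (ℕ.m⊔n≤o⇒n≤o K₁ K₂ K≤k)
       in _
        , ComputedInSize-⊗ F (leftIndex n m k) (rightIndex n m k) _ _ _
            (⊗^-distrib-⊗ F T U k) rank size
        , PowBound-⊗ d {ρ = ρ} {S = S} β γ 1≤a 1≤b
            (U-<-fromℚ β β<a) (U-<-fromℚ γ γ<b) a+b≤q ρ-bound S-bound )
   , ℝ.L-open y Lyq
  where
  0≤1 : 0ℚ ℚ.≤ 1ℚ
  0≤1 = ℚ.nonNegative⁻¹ 1ℚ
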